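{- Let $k$ be a positive integer with $k \equiv 0 \pmod 4$, let $x$ be a positive integer with $x \neq 2$, let $u = kx+1$, and let $g \geq 3$ be odd. Then there exists a $k$-ARCS of $K_u \times K_g$.
   Context: For graphs $G,H$, the tensor product $G \times H$ has vertex set $V(G)\times V(H)$, with $(g_1,h_1)$ adjacent to $(g_2,h_2)$ iff $g_1g_2 \in E(G)$ and $h_1h_2 \in E(H)$. $K_n$ is the complete graph on $n$ vertices. $K_u \times K_g$ is regarded as a $u$-partite graph with partite sets $V_i = \{i\}\times V(K_g)$, $i=1,\dots,u$. A partial $C_k$-factor of $K_u \times K_g$ is a subgraph which, for some $i$, is a spanning subgraph of $(K_u \times K_g)\setminus V_i$ all of whose components are cycles of length $k$. A $k$-ARCS of $K_u \times K_g$ is a partition of its edge set into partial $C_k$-factors. -}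

module Defs where

open import Data.Nat using (ℕ; zero; suc; _%_)
open import Data.Nat.DivMod using (m%n<n)
open import Data.Fin using (Fin; toℕ; fromℕ<)
open import Data.Product using (_×_; _,_; Σ; ∃; ∃-syntax; proj₁)
open import Data.Sum using (_⊎_)
open import Relation.Binary.PropositionalEquality using (_≡_; _≢_)
open import Function.Definitions using (Injective)

-- Vertices of K_u × K_g : pairs (i , a) with i ∈ Fin u, a ∈ Fin g.
-- Partite set V_i = { (i , a) }.
Vertex : ℕ → ℕ → Set
Vertex u g = Fin u × Fin g

Adj : ∀ {u g} → Vertex u g → Vertex u g → Set
Adj (i , a) (j , b) = (i ≢ j) × (a ≢ b)

cyc : ∀ {k} → Fin k → Fin k
cyc {suc n} j = fromℕ< (m%n<n (suc (toℕ j)) (suc n))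

record Cycle (k u g : ℕ) : Set where
  field
    vs  : Fin k → Vertex u g
    inj : Injective _≡_ _≡_ vs
    adj : ∀ j → Adj (vs j) (vs (cyc j))
open Cycle public

EdgeOfCycle : ∀ {k u g} → Cycle k u g → Vertex u g → Vertex u g → Set
EdgeOfCycle C a b =
  ∃[ j ] ((vs C j ≡ a × vs C (cyc j) ≡ b) ⊎ (vs C j ≡ b × vs C (cyc j) ≡ a))

-- A partial C_k-factor of K_u × K_g: for some partite set V_hole, a
-- spanning subgraph of (K_u × K_g) ∖ V_hole all of whose components are
-- k-cycles, i.e. a family of pairwise vertex-disjoint k-cycles avoiding
-- V_hole and covering every vertex outside V_hole.
record PartialFactor (k u g : ℕ) : Set where
  field
    hole     : Fin u
    ncycles  : ℕ
    cycles   : Fin ncycles → Cycle k u g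
    avoid    : ∀ c j → proj₁ (vs (cycles c) j) ≢ hole
    cover    : ∀ (v : Vertex u g) → proj₁ v ≢ hole →
               ∃[ c ] ∃[ j ] (vs (cycles c) j ≡ v)
    disjoint : ∀ c c' j j' → vs (cycles c) j ≡ vs (cycles c') j' → c ≡ c'
open PartialFactor public

EdgeOfFactor : ∀ {k u g} → PartialFactor k u g → Vertex u g → Vertex u g → Set
EdgeOfFactor F a b = ∃[ c ] EdgeOfCycle (cycles F c) a b

record ARCS (k u g : ℕ) : Set where
  field
    nfactors : ℕ
    factors  : Fin nfactors → PartialFactor k u g
    covers   : ∀ (a b : Vertex u g) → Adj a b → ∃[ f ] EdgeOfFactor (factors f) a b
    unique   : ∀ (a b : Vertex u g) (f f' : Fin nfactors) →
               EdgeOfFactor (factors f) a b → EdgeOfFactor (factors f') a b → f ≡ f'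

{-# OPTIONS --safe #-}
module Submission where

-- Write k = 4h.  It suffices to decompose the complete symmetric digraph on u points into factors
-- F_i, one for each point i, where F_i spans all points but i and consists of k-cycles in which
-- sources and sinks alternate: for every d in {1, …, (g − 1)/2} such a cycle b₀ w₀ b₁ w₁ … lifts to
-- the k-cycles (b₀ , a) (w₀ , a + d) (b₁ , a) (w₁ , a + d) … of K_u × K_g, a in Z_g.
--
-- For x = 1 take the α-labelling of the k-cycle by {0, …, k} ∖ {h}, with edge differences 1, …, k,
-- oriented from the low to the high labels, and develop it modulo k + 1.  For x ≥ 3 the points are
-- ∞ and x groups made of two halves of size 2h.  A 1-frame of type 2^x on the halves matches, for
-- each group, the halves of the other groups in two ways; the complete bipartite digraph between two
-- matched halves splits into h alternating Hamiltonian cycles in either direction, and each group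
-- together with ∞ is filled in with the case x = 1.
--
-- Since the counts agree, covering every arc and every vertex at least once means covering it
-- exactly once.

open import Defs
open import Data.Nat using (ℕ; _+_; _*_; _<_; _≤_; _∸_; _%_; zero; suc; s≤s; z≤n)
open import Data.Nat.Divisibility using (_∣_; divides)
open import Data.Nat.DivMod
open import Data.Nat.Properties
open import Data.Nat.Tactic.RingSolver using (solve-∀)
open import Data.Bool using (Bool; true; false; not; _xor_)
open import Data.Bool.Properties using (xor-assoc; xor-same; xor-identityʳ; not-involutive)
open import Data.Fin using (Fin; toℕ; fromℕ<; combine; punchOut)
open import Data.Fin.Patterns using (0F; 1F)
import Data.Fin as Fin
import Data.Fin.Properties as Finₚ
import Data.Maybe as Maybe
open import Data.Maybe using (Maybe; just; nothing)
open import Data.Product using (_×_; _,_; ∃-syntax; proj₁; proj₂)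
open import Data.Product.Function.NonDependent.Propositional using (_×-↔_)
open import Data.Sum using (_⊎_; inj₁; inj₂; swap)
open import Data.Sum.Function.Propositional using (_⊎-↔_)
open import Function.Base using (_∘_)
open import Function.Bundles using (_↔_; Inverse; mk↔ₛ′)
open import Function.Definitions using (Injective)
open import Function.Properties.Inverse using (↔-refl; ↔-sym; ↔-trans)
open import Relation.Binary.Definitions using (tri<; tri≈; tri>)
open import Relation.Nullary using (¬_; yes; no; contradiction)
open import Relation.Binary.PropositionalEquality

-- Counting on finite sets

Finite : Set → ℕ → Set
Finite A n = A ↔ Fin n

resize : ∀ {A n n′} → n ≡ n′ → Finite A n → Finite A n′
resize refl I = I

finite-Maybe : ∀ {A n} → Finite A n → Finite (Maybe A) (suc n)
finite-Maybe {A} {n} I = mk↔ₛ′ to′ from′ to∘from from∘to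
  where
  open Inverse I
  to′ : Maybe A → Fin (suc n)
  to′ nothing  = Fin.zero
  to′ (just a) = Fin.suc (to a)
  from′ : Fin (suc n) → Maybe A
  from′ Fin.zero    = nothing
  from′ (Fin.suc i) = just (from i)
  to∘from : ∀ i → to′ (from′ i) ≡ i
  to∘from Fin.zero    = refl
  to∘from (Fin.suc i) = cong Fin.suc (strictlyInverseˡ i)
  from∘to : ∀ a → from′ (to′ a) ≡ a
  from∘to nothing  = refl
  from∘to (just a) = cong just (strictlyInverseʳ a)

finite-Bool : Finite Bool 2
finite-Bool = ↔-sym Finₚ.2↔Bool

finite-× : ∀ {A B m n} → Finite A m → Finite B n → Finite (A × B) (m * n)
finite-× I J = ↔-trans (I ×-↔ J) (↔-sym Finₚ.*↔×)

finite-⊎ : ∀ {A B m n} → Finite A m → Finite B n → Finite (A ⊎ B) (m + n)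
finite-⊎ I J = ↔-trans (I ⊎-↔ J) (↔-sym Finₚ.+↔⊎)

-- A missed value `y` could be punched out of the range, giving an injection of `Fin (suc n)` into
-- `Fin n`.
injective⇒surjective : ∀ {n} {f : Fin n → Fin n} → Injective _≡_ _≡_ f →
                       ∀ y → ∃[ x ] f x ≡ y
injective⇒surjective {suc n} {f} inj y with Finₚ.any? (λ x → f x Finₚ.≟ y)
... | yes hit = hit
... | no miss = contradiction (Finₚ.injective⇒≤ punch-inj) 1+n≰n
  where
  y≢f : ∀ x → y ≢ f x
  y≢f x eq = miss (x , sym eq)
  punch-inj : Injective _≡_ _≡_ (λ x → punchOut (y≢f x))
  punch-inj {x} {x′} eq = inj (Finₚ.punchOut-injective (y≢f x) (y≢f x′) eq)

↔-injective : ∀ {A B : Set} (I : A ↔ B) → Injective _≡_ _≡_ (Inverse.to I)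
↔-injective I {x} {y} eq =
  trans (sym (strictlyInverseʳ x)) (trans (cong from eq) (strictlyInverseʳ y))
  where open Inverse I

-- A section of `f` is injective, hence onto by counting, hence a two-sided inverse. This turns the
-- coverage statements below into uniqueness statements.
surjective⇒injective : ∀ {A B n n′} → Finite A n → Finite B n′ → n ≡ n′ →
                       {f : A → B} → (∀ b → ∃[ a ] f a ≡ b) → Injective _≡_ _≡_ f
surjective⇒injective {A} {B} I J refl {f} surj {a} {a′} eq =
  trans (sym (section∘f a)) (trans (cong section eq) (section∘f a′))
  where
  module I = Inverse I
  module J = Inverse J
  section : B → A
  section b = proj₁ (surj b)
  f∘section : ∀ b → f (section b) ≡ b
  f∘section b = proj₂ (surj b)
  section-inj : Injective _≡_ _≡_ section
  section-inj {b} {b′} e = trans (sym (f∘section b)) (trans (cong f e) (f∘section b′))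
  G-inj : Injective _≡_ _≡_ (I.to ∘ section ∘ J.from)
  G-inj e = ↔-injective (↔-sym J) (section-inj (↔-injective I e))
  section∘f : ∀ a → section (f a) ≡ a
  section∘f a with injective⇒surjective G-inj (I.to a)
  ... | j , e with ↔-injective I e
  ... | refl = cong section (f∘section (J.from j))

-- Arithmetic modulo n

infixl 6 _⊕_ _⊖_

-- a + toℕ i rather than toℕ i + a, for cyc j and j ⊕ 1 to be definitionally equal.
_⊕_ : ∀ {n} → Fin n → ℕ → Fin n
_⊕_ {suc n} i a = fromℕ< (m%n<n (a + toℕ i) (suc n))

_⊖_ : ∀ {n} → Fin n → ℕ → Fin n
_⊖_ {n} i a = i ⊕ (n ∸ a)

toℕ-⊕ : ∀ {n} (i : Fin (suc n)) a → toℕ (i ⊕ a) ≡ (a + toℕ i) % suc n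
toℕ-⊕ {n} i a = Finₚ.toℕ-fromℕ< (m%n<n (a + toℕ i) (suc n))

%-+ : ∀ a b n → (a + b % suc n) % suc n ≡ (a + b) % suc n
%-+ a b n = begin
  (a + b % suc n) % suc n                 ≡⟨ %-distribˡ-+ a (b % suc n) (suc n) ⟩
  (a % suc n + b % suc n % suc n) % suc n ≡⟨ cong (λ z → (a % suc n + z) % suc n) (m%n%n≡m%n b (suc n)) ⟩
  (a % suc n + b % suc n) % suc n         ≡⟨ %-distribˡ-+ a b (suc n) ⟨
  (a + b) % suc n                         ∎
  where open ≡-Reasoning

⊕-⊕ : ∀ {n} (i : Fin n) a b → i ⊕ a ⊕ b ≡ i ⊕ (b + a)
⊕-⊕ {suc n} i a b = Finₚ.toℕ-injective (begin
  toℕ (i ⊕ a ⊕ b)                     ≡⟨ toℕ-⊕ (i ⊕ a) b ⟩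
  (b + toℕ (i ⊕ a)) % suc n           ≡⟨ cong (λ z → (b + z) % suc n) (toℕ-⊕ i a) ⟩
  (b + (a + toℕ i) % suc n) % suc n   ≡⟨ %-+ b (a + toℕ i) n ⟩
  (b + (a + toℕ i)) % suc n           ≡⟨ cong (_% suc n) (+-assoc b a (toℕ i)) ⟨
  (b + a + toℕ i) % suc n             ≡⟨ toℕ-⊕ i (b + a) ⟨
  toℕ (i ⊕ (b + a))                   ∎)
  where open ≡-Reasoning

⊕-n : ∀ {n} (i : Fin n) → i ⊕ n ≡ i
⊕-n {suc n} i = Finₚ.toℕ-injective (begin
  toℕ (i ⊕ suc n)          ≡⟨ toℕ-⊕ i (suc n) ⟩
  (suc n + toℕ i) % suc n  ≡⟨ cong (_% suc n) (+-comm (suc n) (toℕ i)) ⟩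
  (toℕ i + suc n) % suc n  ≡⟨ [m+n]%n≡m%n (toℕ i) (suc n) ⟩
  toℕ i % suc n            ≡⟨ m<n⇒m%n≡m (Finₚ.toℕ<n i) ⟩
  toℕ i                    ∎)
  where open ≡-Reasoning

⊕-0 : ∀ {n} (i : Fin n) → i ⊕ 0 ≡ i
⊕-0 {suc n} i = Finₚ.toℕ-injective (trans (toℕ-⊕ i 0) (m<n⇒m%n≡m (Finₚ.toℕ<n i)))

⊕-complement : ∀ {n} (i : Fin n) {a b} → b + a ≡ n → i ⊕ a ⊕ b ≡ i
⊕-complement i {a} {b} eq = trans (⊕-⊕ i a b) (trans (cong (i ⊕_) eq) (⊕-n i))

⊖-⊕ : ∀ {n} (i : Fin n) {a} → a ≤ n → i ⊖ a ⊕ a ≡ i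
⊖-⊕ i a≤n = ⊕-complement i (m+[n∸m]≡n a≤n)

⊕-⊖ : ∀ {n} (i : Fin n) {a} → a ≤ n → i ⊕ a ⊖ a ≡ i
⊕-⊖ i a≤n = ⊕-complement i (m∸n+n≡m a≤n)

gap : ∀ {n} (i j : Fin n) → ∃[ a ] (a < n × i ⊕ a ≡ j)
gap {suc n} i j = toℕ (j ⊖ toℕ i) , Finₚ.toℕ<n (j ⊖ toℕ i) , Finₚ.toℕ-injective (begin
  toℕ (i ⊕ toℕ (j ⊖ toℕ i))                              ≡⟨ toℕ-⊕ i (toℕ (j ⊖ toℕ i)) ⟩
  (toℕ (j ⊖ toℕ i) + toℕ i) % suc n                      ≡⟨ cong (_% suc n) (+-comm (toℕ (j ⊖ toℕ i)) (toℕ i)) ⟩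
  (toℕ i + toℕ (j ⊖ toℕ i)) % suc n                      ≡⟨ toℕ-⊕ (j ⊖ toℕ i) (toℕ i) ⟨
  toℕ (j ⊖ toℕ i ⊕ toℕ i)                                ≡⟨ cong toℕ (⊖-⊕ j (<⇒≤ (Finₚ.toℕ<n i))) ⟩
  toℕ j                                                  ∎)
  where open ≡-Reasoning

gap⁺ : ∀ {n} (i j : Fin n) → i ≡ j ⊎ ∃[ a ] (suc a < n × i ⊕ suc a ≡ j)
gap⁺ i j with gap i j
... | zero  , _   , eq = inj₁ (trans (sym (⊕-0 i)) eq)
... | suc a , a<n , eq = inj₂ (a , a<n , eq)

cyc≡⊕1 : ∀ {n} (j : Fin n) → cyc j ≡ j ⊕ 1
cyc≡⊕1 {suc n} j = refl

toℕ-cyc : ∀ {n} (j : Fin n) → suc (toℕ j) < n → toℕ (cyc j) ≡ suc (toℕ j)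
toℕ-cyc {suc n} j lt = trans (Finₚ.toℕ-fromℕ< (m%n<n (suc (toℕ j)) (suc n))) (m<n⇒m%n≡m lt)

toℕ-cyc-last : ∀ {n} (j : Fin n) → suc (toℕ j) ≡ n → toℕ (cyc j) ≡ 0
toℕ-cyc-last {suc n} j eq =
  trans (Finₚ.toℕ-fromℕ< (m%n<n (suc (toℕ j)) (suc n))) (trans (cong (_% suc n) eq) (n%n≡0 (suc n)))

-- Signed steps and midpoints on an odd cycle

parity : ∀ a → ∃[ b ] (a ≡ b + b ⊎ a ≡ suc (b + b))
parity zero = 0 , inj₁ refl
parity (suc a) with parity a
... | b , inj₁ eq = b , inj₂ (cong suc eq)
... | b , inj₂ eq = suc b , inj₁ (trans (cong suc eq) (cong suc (sym (+-suc b b))))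

double-cancel-≤ : ∀ {a b} → a + a ≤ b + b → a ≤ b
double-cancel-≤ {a} {b} le with <-≤-connex b a
... | inj₂ a≤b = a≤b
... | inj₁ b<a = contradiction le (<⇒≱ (+-mono-< b<a b<a))

double-cancel-< : ∀ {a b} → a + a < b + b → a < b
double-cancel-< {a} {b} lt with <-≤-connex a b
... | inj₁ a<b = a<b
... | inj₂ b≤a = contradiction lt (≤⇒≯ (+-mono-≤ b≤a b≤a))

regroup : ∀ c b → (suc c + suc c) + suc (b + b) ≡ suc ((suc c + b) + (suc c + b))
regroup = solve-∀

module _ {ρ : ℕ} where

  -- The steps `± (t + 1)` with `t < ρ` run once through the nonzero residues modulo `2ρ + 1`.
  shift : Bool → Fin (suc (ρ + ρ)) → Fin ρ → Fin (suc (ρ + ρ))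
  shift true  y t = y ⊕ suc (toℕ t)
  shift false y t = y ⊖ suc (toℕ t)

  step≤ : ∀ (t : Fin ρ) → suc (toℕ t) ≤ suc (ρ + ρ)
  step≤ t = ≤-trans (Finₚ.toℕ<n t) (m≤n⇒m≤1+n (m≤m+n ρ ρ))

  shift-shift : ∀ s y t → shift (not s) (shift s y t) t ≡ y
  shift-shift true  y t = ⊕-⊖ y (step≤ t)
  shift-shift false y t = ⊖-⊕ y (step≤ t)

  shift-cover : ∀ y z → z ≡ y ⊎ ∃[ s ] ∃[ t ] shift s y t ≡ z
  shift-cover y z with gap⁺ y z
  ... | inj₁ eq = inj₁ (sym eq)
  ... | inj₂ (a , s≤s a<2ρ , eq) with <-≤-connex a ρ
  ...   | inj₁ a<ρ = inj₂ (true , fromℕ< a<ρ , trans (cong (λ i → y ⊕ suc i) (Finₚ.toℕ-fromℕ< a<ρ)) eq)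
  -- The step `a + 1` exceeds `ρ`, so it is taken backwards with length `2ρ − a`; the index is one
  -- less than this length.
  ...   | inj₂ ρ≤a = inj₂ (false , fromℕ< b<ρ , trans (cong (y ⊕_) step≡) eq)
    where
    b<ρ : ρ + ρ ∸ suc a < ρ
    b<ρ = +-cancelʳ-< (suc a) _ _ (subst (_< ρ + suc a) (sym (m∸n+n≡m a<2ρ)) (+-monoʳ-< ρ (s≤s ρ≤a)))
    step≡ : ρ + ρ ∸ toℕ (fromℕ< b<ρ) ≡ suc a
    step≡ = trans (cong (ρ + ρ ∸_) (Finₚ.toℕ-fromℕ< b<ρ)) (m∸[m∸n]≡n a<2ρ)

  middle : ∀ {p q b} → b < ρ → p ⊕ (suc b + suc b) ≡ q →
           ∃[ y ] ∃[ t ] (shift false y t ≡ p × shift true y t ≡ q)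
  middle {p} {q} {b} b<ρ eq = p ⊕ suc (toℕ t) , t , ⊕-⊖ p (step≤ t) , (begin
    p ⊕ suc (toℕ t) ⊕ suc (toℕ t)    ≡⟨ ⊕-⊕ p (suc (toℕ t)) (suc (toℕ t)) ⟩
    p ⊕ (suc (toℕ t) + suc (toℕ t))  ≡⟨ cong (λ i → p ⊕ (suc i + suc i)) (Finₚ.toℕ-fromℕ< b<ρ) ⟩
    p ⊕ (suc b + suc b)              ≡⟨ eq ⟩
    q                                ∎)
    where
    open ≡-Reasoning
    t = fromℕ< b<ρ

  -- One of the two arcs between p and q on the odd cycle has even length; y is its midpoint.
  midpoint : ∀ p q → p ≡ q ⊎ ∃[ y ] ∃[ t ] ∃[ s ] (shift s y t ≡ p × shift (not s) y t ≡ q)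
  midpoint p q with gap⁺ p q
  ... | inj₁ eq = inj₁ eq
  ... | inj₂ (a , s≤s a<2ρ , eq) with parity a
  ...   | b , inj₁ refl = inj₂ (y , t , true , p≡ , q≡)
    where
    b<ρ : b < ρ
    b<ρ = double-cancel-< a<2ρ
    c = ρ ∸ suc b
    c+b : suc c + b ≡ ρ
    c+b = trans (sym (+-suc c b)) (m∸n+n≡m b<ρ)
    total : (suc c + suc c) + suc (b + b) ≡ suc (ρ + ρ)
    total = trans (regroup c b) (cong (λ z → suc (z + z)) c+b)
    q-to-p : q ⊕ (suc c + suc c) ≡ p
    q-to-p = trans (cong (_⊕ (suc c + suc c)) (sym eq)) (⊕-complement p {suc (b + b)} {suc c + suc c} total)
    m = middle (≤-trans (m≤m+n (suc c) b) (≤-reflexive c+b)) q-to-p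
    y = proj₁ m
    t = proj₁ (proj₂ m)
    q≡ = proj₁ (proj₂ (proj₂ m))
    p≡ = proj₂ (proj₂ (proj₂ m))
  ...   | b , inj₂ refl = inj₂ (y , t , false , p≡ , q≡)
    where
    m = middle (double-cancel-≤ {suc b} (subst (_≤ ρ + ρ) (cong suc (sym (+-suc b b))) a<2ρ))
               (trans (cong (p ⊕_) (cong suc (+-suc b b))) eq)
    y = proj₁ m
    t = proj₁ (proj₂ m)
    p≡ = proj₁ (proj₂ (proj₂ m))
    q≡ = proj₂ (proj₂ (proj₂ m))

-- Designs of alternating cycles

-- Serves twice: to choose one of the two sources joined to sink `j`, and as the change of index
-- along the cycle, which stays put from source to sink and advances from sink to source.
next : ∀ {m} → Bool → Fin m → Fin m
next false j = j
next true  j = cyc j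

-- For every point i there is a factor missing only i, made of x alternating cycles of length 2m:
-- pt i c s j is the j-th source (s = false) or sink (s = true) of the c-th cycle, whose arcs run
-- from the sources j and j + 1 to the sink j.
record Design (m x : ℕ) (P : Set) : Set where
  field
    pt        : P → Fin x → Bool → Fin m → P
    pt-cover  : ∀ i p → p ≡ i ⊎ ∃[ c ] ∃[ s ] ∃[ j ] pt i c s j ≡ p
    arc-cover : ∀ p q → p ≡ q ⊎
                ∃[ i ] ∃[ c ] ∃[ j ] ∃[ e ] (pt i c false (next e j) ≡ p × pt i c true j ≡ q)

transport : ∀ {m x P Q} → P ↔ Q → Design m x P → Design m x Q
transport {m} {x} {P} {Q} I D = record { pt = pt′ ; pt-cover = pt-cover′ ; arc-cover = arc-cover′ }
  where
  open Inverse I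
  open Design D
  pt′ : Q → Fin x → Bool → Fin m → Q
  pt′ i c s j = to (pt (from i) c s j)
  to≡ : ∀ {p q} → p ≡ from q → to p ≡ q
  to≡ {q = q} eq = trans (cong to eq) (strictlyInverseˡ q)
  pt-cover′ : ∀ i p → p ≡ i ⊎ ∃[ c ] ∃[ s ] ∃[ j ] pt′ i c s j ≡ p
  pt-cover′ i p with pt-cover (from i) (from p)
  ... | inj₁ eq = inj₁ (↔-injective (↔-sym I) eq)
  ... | inj₂ (c , s , j , eq) = inj₂ (c , s , j , to≡ eq)
  arc-cover′ : ∀ p q → p ≡ q ⊎
    ∃[ i ] ∃[ c ] ∃[ j ] ∃[ e ] (pt′ i c false (next e j) ≡ p × pt′ i c true j ≡ q)
  arc-cover′ p q with arc-cover (from p) (from q)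
  ... | inj₁ eq = inj₁ (↔-injective (↔-sym I) eq)
  ... | inj₂ (i , c , j , e , p≡ , q≡) =
    inj₂ (to i , c , j , e , to≡ (trans (pt-to false (next e j)) p≡) , to≡ (trans (pt-to true j) q≡))
    where
    pt-to : ∀ s j → pt (from (to i)) c s j ≡ pt i c s j
    pt-to s j = cong (λ z → pt z c s j) (strictlyInverseʳ i)

-- Lifting a design to an ARCS

nodes : ∀ {m} → Finite (Fin m × Bool) (m * 2)
nodes = finite-× ↔-refl finite-Bool

-- The node `(j , s)` has position `2j + s`. The wrap-around after the last sink agrees on both
-- sides because reducing a doubled number modulo `2m` doubles its residue modulo `m`.
cyc-node : ∀ {m} (j : Fin m) s →
           cyc (Inverse.to nodes (j , s)) ≡ Inverse.to nodes (next s j , not s)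
cyc-node {suc m} j false = Finₚ.toℕ-injective (begin
  toℕ (cyc (combine j 0F))          ≡⟨ Finₚ.toℕ-fromℕ< (m%n<n (suc (toℕ (combine j 0F))) (suc m * 2)) ⟩
  suc (toℕ (combine j 0F)) % (suc m * 2) ≡⟨ cong (_% (suc m * 2)) suc≡ ⟩
  toℕ (combine j 1F) % (suc m * 2)  ≡⟨ m<n⇒m%n≡m (Finₚ.toℕ<n (combine j 1F)) ⟩
  toℕ (combine j 1F)                ∎)
  where
  open ≡-Reasoning
  suc≡ : suc (toℕ (combine j 0F)) ≡ toℕ (combine j 1F)
  suc≡ = trans (cong suc (Finₚ.toℕ-combine j 0F))
        (trans (sym (+-suc (2 * toℕ j) 0)) (sym (Finₚ.toℕ-combine j 1F)))
cyc-node {suc m} j true = Finₚ.toℕ-injective (begin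
  toℕ (cyc (combine j 1F))          ≡⟨ Finₚ.toℕ-fromℕ< (m%n<n (suc (toℕ (combine j 1F))) (suc m * 2)) ⟩
  suc (toℕ (combine j 1F)) % (suc m * 2) ≡⟨ cong (λ z → suc z % (suc m * 2)) (Finₚ.toℕ-combine j 1F) ⟩
  suc (2 * toℕ j + 1) % (suc m * 2) ≡⟨ cong (_% (suc m * 2)) (double (toℕ j)) ⟩
  (suc (toℕ j) * 2) % (suc m * 2)   ≡⟨ m%n*o≡m*o%[n*o] (suc (toℕ j)) (suc m) 2 ⟨
  suc (toℕ j) % suc m * 2           ≡⟨ cong (_* 2) (Finₚ.toℕ-fromℕ< (m%n<n (suc (toℕ j)) (suc m))) ⟨
  toℕ (cyc j) * 2                   ≡⟨ double′ (toℕ (cyc j)) ⟩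
  2 * toℕ (cyc j) + 0               ≡⟨ Finₚ.toℕ-combine (cyc j) 0F ⟨
  toℕ (combine (cyc j) 0F)          ∎)
  where
  open ≡-Reasoning
  double : ∀ a → suc (2 * a + 1) ≡ suc a * 2
  double = solve-∀
  double′ : ∀ a → a * 2 ≡ 2 * a + 0
  double′ = solve-∀

module Lift {m x : ℕ} (ρ : ℕ) (D : Design m x (Fin (m * 2 * x + 1))) where
  open Design D

  u g : ℕ
  u = m * 2 * x + 1
  g = suc (ρ + ρ)

  -- The hole is adjoined as `nothing` so that both sides have `2mx + 1` elements. Injectivity then
  -- says that the points of a factor are distinct and differ from the hole.
  factorPoint : Fin u → Maybe (Fin x × Bool × Fin m) → Fin u
  factorPoint i nothing            = i
  factorPoint i (just (c , s , j)) = pt i c s j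

  factorPoint-injective : ∀ i → Injective _≡_ _≡_ (factorPoint i)
  factorPoint-injective i = surjective⇒injective
    (finite-Maybe (finite-× ↔-refl (finite-× finite-Bool ↔-refl))) ↔-refl (size m x) surj
    where
    size : ∀ m x → suc (x * (2 * m)) ≡ m * 2 * x + 1
    size = solve-∀
    surj : ∀ p → ∃[ a ] factorPoint i a ≡ p
    surj p with pt-cover i p
    ... | inj₁ eq = nothing , sym eq
    ... | inj₂ (c , s , j , eq) = just (c , s , j) , eq

  pt-injective : ∀ {i c s j c′ s′ j′} → pt i c s j ≡ pt i c′ s′ j′ → (c , s , j) ≡ (c′ , s′ , j′)
  pt-injective {i} eq with factorPoint-injective i {just _} {just _} eq
  ... | refl = refl

  -- The diagonal is adjoined to fill the whole square, for the count `u · 2mx + u = u²`.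
  arc : (Fin u × Fin x × Fin m × Bool) ⊎ Fin u → Fin u × Fin u
  arc (inj₁ (i , c , j , e)) = pt i c false (next e j) , pt i c true j
  arc (inj₂ p)               = p , p

  arc-injective : Injective _≡_ _≡_ arc
  arc-injective = surjective⇒injective
    (finite-⊎ (finite-× ↔-refl (finite-× ↔-refl (finite-× ↔-refl finite-Bool))) ↔-refl)
    (finite-× ↔-refl ↔-refl) (size m x) surj
    where
    size : ∀ m x → (m * 2 * x + 1) * (x * (m * 2)) + (m * 2 * x + 1) ≡ (m * 2 * x + 1) * (m * 2 * x + 1)
    size = solve-∀
    surj : ∀ b → ∃[ a ] arc a ≡ b
    surj (p , q) with arc-cover p q
    ... | inj₁ refl = inj₂ p , refl
    ... | inj₂ (i , c , j , e , p≡ , q≡) = inj₁ (i , c , j , e) , cong₂ _,_ p≡ q≡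

  σ : Fin ρ → Fin g → Fin g
  σ d a = shift true a d

  σ-surjective : ∀ d b → σ d (shift false b d) ≡ b
  σ-surjective d b = shift-shift false b d

  σ-injective : ∀ {d a a′} → σ d a ≡ σ d a′ → a ≡ a′
  σ-injective {d} {a} {a′} eq =
    trans (sym (shift-shift true a d)) (trans (cong (λ z → shift false z d) eq) (shift-shift true a′ d))

  σ-cover : ∀ a b → a ≡ b ⊎ ∃[ d ] (σ d a ≡ b ⊎ σ d b ≡ a)
  σ-cover a b with shift-cover a b
  ... | inj₁ eq = inj₁ (sym eq)
  ... | inj₂ (true  , d , eq) = inj₂ (d , inj₁ eq)
  ... | inj₂ (false , d , eq) = inj₂ (d , inj₂ (trans (cong (σ d) (sym eq)) (σ-surjective d a)))

  -- The same device for levels, with the count `2ρg + g = g²`. The Boolean separates a pair from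
  -- its reverse.
  pair : (Fin ρ × Bool × Fin g) ⊎ Fin g → Fin g × Fin g
  pair (inj₁ (d , true  , a)) = a , σ d a
  pair (inj₁ (d , false , a)) = σ d a , a
  pair (inj₂ a)               = a , a

  pair-injective : Injective _≡_ _≡_ pair
  pair-injective = surjective⇒injective
    (finite-⊎ (finite-× ↔-refl (finite-× finite-Bool ↔-refl)) ↔-refl)
    (finite-× ↔-refl ↔-refl) (size ρ) surj
    where
    size : ∀ ρ → ρ * (2 * suc (ρ + ρ)) + suc (ρ + ρ) ≡ suc (ρ + ρ) * suc (ρ + ρ)
    size = solve-∀
    surj : ∀ b → ∃[ a ] pair a ≡ b
    surj (a , b) with σ-cover a b
    ... | inj₁ refl            = inj₂ a , refl
    ... | inj₂ (d , inj₁ refl) = inj₁ (d , true , a) , refl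
    ... | inj₂ (d , inj₂ refl) = inj₁ (d , false , b) , refl

  σ-fixed-point-free : ∀ {d a} → a ≢ σ d a
  σ-fixed-point-free {d} {a} eq with pair-injective {inj₂ a} {inj₁ (d , true , a)} (cong (a ,_) eq)
  ... | ()

  level : Fin ρ → Bool → Fin g → Fin g
  level d false a = a
  level d true  a = σ d a

  level-injective : ∀ {d a a′} s → level d s a ≡ level d s a′ → a ≡ a′
  level-injective false eq = eq
  level-injective true  eq = σ-injective eq

  level-surjective : ∀ d s b → ∃[ a ] level d s a ≡ b
  level-surjective d false b = b , refl
  level-surjective d true  b = shift false b d , σ-surjective d b

  vertex : Fin ρ → Fin u → Fin x × Fin g → Fin m × Bool → Vertex u g
  vertex d i (c , a) (j , s) = pt i c s j , level d s a

  vertex-injective : ∀ {d i q q′ n n′} → vertex d i q n ≡ vertex d i q′ n′ → (q , n) ≡ (q′ , n′)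
  vertex-injective {q = c , a} {n = j , s} eq with pt-injective (cong proj₁ eq)
  ... | refl with level-injective s (cong proj₂ eq)
  ... | refl = refl

  unnode : Fin (m * 2) → Fin m × Bool
  unnode = Inverse.from nodes

  unnode-node : ∀ n → unnode (Inverse.to nodes n) ≡ n
  unnode-node = Inverse.strictlyInverseʳ nodes

  successor : Fin m × Bool → Fin m × Bool
  successor (j , s) = next s j , not s

  unnode-cyc : ∀ n → unnode (cyc n) ≡ successor (unnode n)
  unnode-cyc n = begin
    unnode (cyc n)                                  ≡⟨ cong (unnode ∘ cyc) (Inverse.strictlyInverseˡ (nodes {m}) n) ⟨
    unnode (cyc (Inverse.to nodes (unnode n)))      ≡⟨ cong unnode (cyc-node (proj₁ (unnode n)) (proj₂ (unnode n))) ⟩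
    unnode (Inverse.to nodes (successor (unnode n))) ≡⟨ unnode-node (successor (unnode n)) ⟩
    successor (unnode n)                            ∎
    where open ≡-Reasoning

  vertex-adj : ∀ d i q n → Adj (vertex d i q n) (vertex d i q (successor n))
  vertex-adj d i (c , a) (j , s) = points s , levels s
    where
    points : ∀ s → pt i c s j ≢ pt i c (not s) (next s j)
    points false eq with pt-injective eq
    ... | ()
    points true eq with pt-injective eq
    ... | ()
    levels : ∀ s → level d s a ≢ level d (not s) a
    levels false = σ-fixed-point-free
    levels true  = σ-fixed-point-free ∘ sym

  liftedCycle : Fin ρ → Fin u → Fin x × Fin g → Cycle (m * 2) u g
  liftedCycle d i q = record
    { vs  = vertex d i q ∘ unnode
    ; inj = λ eq → ↔-injective (↔-sym nodes) (cong proj₂ (vertex-injective {q = q} {q} eq))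
    ; adj = λ n → subst (λ z → Adj (vertex d i q (unnode n)) (vertex d i q z))
                        (sym (unnode-cyc n)) (vertex-adj d i q (unnode n))
    }

  cycleIndices : Finite (Fin x × Fin g) (x * g)
  cycleIndices = finite-× ↔-refl ↔-refl

  cycleIndex : Fin (x * g) → Fin x × Fin g
  cycleIndex = Inverse.from cycleIndices

  liftedFactor : Fin ρ → Fin u → PartialFactor (m * 2) u g
  liftedFactor d i = record
    { hole     = i
    ; ncycles  = x * g
    ; cycles   = λ q → liftedCycle d i (cycleIndex q)
    ; avoid    = avoids
    ; cover    = covers
    ; disjoint = λ q q′ n n′ eq →
        ↔-injective (↔-sym cycleIndices) (cong proj₁ (vertex-injective {n = unnode n} {unnode n′} eq))
    }
    where
    avoids : ∀ q n → proj₁ (vertex d i (cycleIndex q) (unnode n)) ≢ i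
    avoids q n eq with factorPoint-injective i {just _} {nothing} eq
    ... | ()
    covers : ∀ v → proj₁ v ≢ i → ∃[ q ] ∃[ n ] vertex d i (cycleIndex q) (unnode n) ≡ v
    covers (p , b) p≢i with pt-cover i p
    ... | inj₁ eq = contradiction eq p≢i
    ... | inj₂ (c , s , j , refl) with level-surjective d s b
    ... | a , refl = Inverse.to cycleIndices (c , a) , Inverse.to nodes (j , s) ,
      cong₂ (vertex d i) (Inverse.strictlyInverseʳ cycleIndices (c , a)) (unnode-node (j , s))

  -- Edges of a lifted factor oriented from source to sink, so that the level always rises by the
  -- positive step `d + 1`.
  LiftedArc : Fin ρ → Fin u → Vertex u g → Vertex u g → Set
  LiftedArc d i v w = ∃[ c ] ∃[ j ] ∃[ e ] ∃[ a ]
    ((pt i c false (next e j) , a) ≡ v × (pt i c true j , σ d a) ≡ w)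

  arc⇒edge : ∀ {d i v w} → LiftedArc d i v w → EdgeOfFactor (liftedFactor d i) v w
  arc⇒edge {d} {i} (c , j , e , a , refl , refl) = q , n , edge e refl
    where
    q = Inverse.to cycleIndices (c , a)
    n = Inverse.to nodes (j , e)
    here : vertex d i (cycleIndex q) (unnode n) ≡ vertex d i (c , a) (j , e)
    here = cong₂ (vertex d i) (Inverse.strictlyInverseʳ cycleIndices (c , a)) (unnode-node (j , e))
    there : vertex d i (cycleIndex q) (unnode (cyc n)) ≡ vertex d i (c , a) (successor (j , e))
    there = cong₂ (vertex d i) (Inverse.strictlyInverseʳ cycleIndices (c , a))
                  (trans (unnode-cyc n) (cong successor (unnode-node (j , e))))
    v = pt i c false (next e j) , a
    w = pt i c true j , σ d a
    edge : ∀ e′ → e ≡ e′ → let C = liftedCycle d i (cycleIndex q) in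
           (vs C n ≡ v × vs C (cyc n) ≡ w) ⊎ (vs C n ≡ w × vs C (cyc n) ≡ v)
    edge false refl = inj₁ (here , there)
    edge true  refl = inj₂ (here , there)

  EdgeOfFactor-sym : ∀ {F : PartialFactor (m * 2) u g} {v w} → EdgeOfFactor F v w → EdgeOfFactor F w v
  EdgeOfFactor-sym (q , n , e) = q , n , swap e

  step-arc : ∀ d i q n → let v = vertex d i q n ; w = vertex d i q (successor n) in
             LiftedArc d i v w ⊎ LiftedArc d i w v
  step-arc d i (c , a) (j , false) = inj₁ (c , j , false , a , refl , refl)
  step-arc d i (c , a) (j , true)  = inj₂ (c , j , true , a , refl , refl)

  edge⇒arc : ∀ {d i v w} → EdgeOfFactor (liftedFactor d i) v w → LiftedArc d i v w ⊎ LiftedArc d i w v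
  edge⇒arc {d} {i} (q , n , E) = orient E
    where
    consecutive : let v = vertex d i (cycleIndex q) (unnode n)
                      w = vertex d i (cycleIndex q) (unnode (cyc n)) in
                  LiftedArc d i v w ⊎ LiftedArc d i w v
    consecutive = subst (λ z → let v = vertex d i (cycleIndex q) (unnode n)
                                   w = vertex d i (cycleIndex q) z in
                               LiftedArc d i v w ⊎ LiftedArc d i w v)
                        (sym (unnode-cyc n)) (step-arc d i (cycleIndex q) (unnode n))
    orient : ∀ {v w} → let C = liftedCycle d i (cycleIndex q) in
             (vs C n ≡ v × vs C (cyc n) ≡ w) ⊎ (vs C n ≡ w × vs C (cyc n) ≡ v) →
             LiftedArc d i v w ⊎ LiftedArc d i w v
    orient (inj₁ (refl , refl)) = consecutive
    orient (inj₂ (refl , refl)) = swap consecutive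

  -- The two points determine the hole `i`, the two levels determine `d`.
  LiftedArc-unique : ∀ {d i d′ i′ v w} → LiftedArc d i v w → LiftedArc d′ i′ v w → (d , i) ≡ (d′ , i′)
  LiftedArc-unique {d} {i} {d′} {i′} (c , j , e , a , refl , refl) (c′ , j′ , e′ , a′ , v≡ , w≡)
    with arc-injective {inj₁ (i′ , c′ , j′ , e′)} {inj₁ (i , c , j , e)}
                       (cong₂ _,_ (cong proj₁ v≡) (cong proj₁ w≡))
       | pair-injective {inj₁ (d′ , true , a′)} {inj₁ (d , true , a)}
                        (cong₂ _,_ (cong proj₂ v≡) (cong proj₂ w≡))
  ... | refl | refl = refl

  -- Reversal negates the change of level, and no two steps from 1 to `ρ` add up to zero modulo
  -- `2ρ + 1`.
  LiftedArc-asym : ∀ {d i d′ i′ v w} → LiftedArc d i v w → ¬ LiftedArc d′ i′ w v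
  LiftedArc-asym {d} {i} {d′} {i′} (c , j , e , a , refl , refl) (c′ , j′ , e′ , a′ , w≡ , v≡)
    with pair-injective {inj₁ (d′ , false , a′)} {inj₁ (d , true , a)}
                        (cong₂ _,_ (cong proj₂ v≡) (cong proj₂ w≡))
  ... | ()

  edge-unique : ∀ {d i d′ i′} v w → EdgeOfFactor (liftedFactor d i) v w →
                EdgeOfFactor (liftedFactor d′ i′) v w → (d , i) ≡ (d′ , i′)
  edge-unique v w E E′ with edge⇒arc E | edge⇒arc E′
  ... | inj₁ A | inj₁ A′ = LiftedArc-unique A A′
  ... | inj₂ A | inj₂ A′ = LiftedArc-unique A A′
  ... | inj₁ A | inj₂ A′ = contradiction A′ (LiftedArc-asym A)
  ... | inj₂ A | inj₁ A′ = contradiction A′ (LiftedArc-asym A)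

  arc-exists : ∀ {p q} d a → p ≢ q → ∃[ i ] LiftedArc d i (p , a) (q , σ d a)
  arc-exists {p} {q} d a p≢q with arc-cover p q
  ... | inj₁ eq = contradiction eq p≢q
  ... | inj₂ (i , c , j , e , refl , refl) = i , c , j , e , a , refl , refl

  edge-exists : ∀ v w → Adj v w → ∃[ d ] ∃[ i ] EdgeOfFactor (liftedFactor d i) v w
  edge-exists (p , a) (q , b) (p≢q , a≢b) with σ-cover a b
  ... | inj₁ eq = contradiction eq a≢b
  ... | inj₂ (d , inj₁ refl) with arc-exists d a p≢q
  ...   | i , A = d , i , arc⇒edge A
  -- The level rises from `b` to `a`, so the edge comes from the arc `q` to `p`, read backwards.
  edge-exists (p , a) (q , b) (p≢q , a≢b) | inj₂ (d , inj₂ refl) with arc-exists d b (p≢q ∘ sym)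
  ...   | i , A = d , i , EdgeOfFactor-sym {liftedFactor d i} (arc⇒edge A)

  factorIndices : Finite (Fin ρ × Fin u) (ρ * u)
  factorIndices = finite-× ↔-refl ↔-refl

  arcs : ARCS (m * 2) u g
  arcs = record
    { nfactors = ρ * u
    ; factors  = factor ∘ Inverse.from factorIndices
    ; covers   = covers
    ; unique   = λ v w f f′ E E′ → ↔-injective (↔-sym factorIndices) (edge-unique v w E E′)
    }
    where
    factor : Fin ρ × Fin u → PartialFactor (m * 2) u g
    factor (d , i) = liftedFactor d i
    covers : ∀ v w → Adj v w → ∃[ f ] EdgeOfFactor (factor (Inverse.from factorIndices f)) v w
    covers v w adjacent with edge-exists v w adjacent
    ... | d , i , E = Inverse.to factorIndices (d , i) ,
      subst (λ z → EdgeOfFactor (factor z) v w) (sym (Inverse.strictlyInverseʳ factorIndices (d , i))) E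

-- The case x = 1

-- The α-labelling low 0, high 0, low 1, high 1, … of the cycle of length 4h: the labels are
-- 0, …, 4h without h, and the differences high − low along the edges are 1, …, 4h.
module Labels (h : ℕ) where

  m : ℕ
  m = h + h

  low high : ℕ → ℕ
  low j with <-≤-connex j h
  ... | inj₁ _ = j
  ... | inj₂ _ = suc j
  high j = m + m ∸ j

  low-< : ∀ {j} → j < h → low j ≡ j
  low-< {j} j<h with <-≤-connex j h
  ... | inj₁ _   = refl
  ... | inj₂ h≤j = contradiction j<h (≤⇒≯ h≤j)

  low-≥ : ∀ {j} → h ≤ j → low j ≡ suc j
  low-≥ {j} h≤j with <-≤-connex j h
  ... | inj₁ j<h = contradiction j<h (≤⇒≯ h≤j)
  ... | inj₂ _   = refl

  low≤ : ∀ {j} → j < m → low j ≤ m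
  low≤ {j} j<m with <-≤-connex j h
  ... | inj₁ _ = <⇒≤ j<m
  ... | inj₂ _ = j<m

  label : Bool → ℕ → ℕ
  label false = low
  label true  = high

  -- Low labels fill `0` to `h − 1` for indices below `h` and `h + 1` to `m` for the others; high
  -- labels fill `m + 1` to `2m`.
  label-cover : ∀ {a} → a ≤ m + m → a ≡ h ⊎ ∃[ s ] ∃[ j ] label s (toℕ {m} j) ≡ a
  label-cover {a} a≤ with <-cmp a h
  ... | tri≈ _ a≡h _ = inj₁ a≡h
  ... | tri< a<h _ _ = inj₂ (false , fromℕ< a<m ,
                             trans (cong low (Finₚ.toℕ-fromℕ< a<m)) (low-< a<h))
    where
    a<m : a < m
    a<m = ≤-trans a<h (m≤m+n h h)
  label-cover {suc a} a≤ | tri> _ _ (s≤s h≤a) with <-≤-connex a m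
  ... | inj₁ a<m = inj₂ (false , fromℕ< a<m ,
                         trans (cong low (Finₚ.toℕ-fromℕ< a<m)) (low-≥ h≤a))
  ... | inj₂ m≤a = inj₂ (true , fromℕ< j<m ,
                         trans (cong high (Finₚ.toℕ-fromℕ< j<m)) (m∸[m∸n]≡n a≤))
    where
    j<m : m + m ∸ suc a < m
    j<m = +-cancelʳ-< (suc a) _ _ (subst (_< m + suc a) (sym (m∸n+n≡m a≤)) (+-monoʳ-< m (s≤s m≤a)))

  -- The equation `high j − low (next e j) = D` without subtraction.
  Difference : ℕ → Set
  Difference D = ∃[ j ] ∃[ e ] (low (toℕ {m} (next e j)) + D + toℕ j ≡ m + m)

  straight : ∀ {D} j → j < m → low j + D + j ≡ m + m → Difference D
  straight {D} j j<m eq = fromℕ< j<m , false ,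
    trans (cong (λ z → low z + D + z) (Finₚ.toℕ-fromℕ< j<m)) eq

  slanted : ∀ {D} j → suc j < m → low (suc j) + D + j ≡ m + m → Difference D
  slanted {D} j sj<m eq = i , true ,
    trans (cong₂ (λ y z → low y + D + z)
                 (trans (toℕ-cyc i (subst (λ z → suc z < m) (sym i≡j) sj<m)) (cong suc i≡j)) i≡j) eq
    where
    i = fromℕ< (<⇒≤ sj<m)
    i≡j = Finₚ.toℕ-fromℕ< (<⇒≤ sj<m)

  closing : ∀ {D} j → suc j ≡ m → 0 < h → D + j ≡ m + m → Difference D
  closing {D} j sj≡m 0<h eq = i , true ,
    trans (cong₂ (λ y z → low y + D + z) (toℕ-cyc-last i (trans (cong suc i≡j) sj≡m)) i≡j)
          (trans (cong (λ y → y + D + j) (low-< 0<h)) eq)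
    where
    i = fromℕ< (≤-reflexive sj≡m)
    i≡j = Finₚ.toℕ-fromℕ< (≤-reflexive sj≡m)

  summand-≥ : ∀ {a b} → a + b ≡ m → b ≤ h → h ≤ a
  summand-≥ {a} {b} eq b≤h = +-cancelʳ-≤ h h a (subst (_≤ a + h) eq (+-monoʳ-≤ a b≤h))

  summand-< : ∀ {a b} → a + b ≡ m → h < b → a < h
  summand-< {a} {b} eq h<b = +-cancelʳ-< h a h (subst (a + h <_) eq (+-monoʳ-< a h<b))

  odd-total : ∀ c b → suc c + suc (b + b) + c ≡ (c + suc b) + (c + suc b)
  odd-total = solve-∀

  -- Odd differences: up to `2h − 1` from the edges `low j`, `high j` with `j ≥ h`; `2h + 1` from
  -- the closing edge `low 0`, `high (m − 1)`; larger ones from `low (j + 1)`, `high j` with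
  -- `j + 1 < h`. Even differences: up to `2h` from slanted edges with `j + 1 ≥ h`, larger ones from
  -- straight edges with `j < h`.
  differences : ∀ D → D < m + m → Difference (suc D)
  differences D D< with parity D
  differences D D< | b , inj₁ refl with m ∸ suc b | m∸n+n≡m (double-cancel-< {b} {m} D<)
  ... | c | c+sb≡m with <-cmp b h
  ...   | tri< b<h _ _ = straight c c<m
    (trans (cong (λ z → z + suc (b + b) + c) (low-≥ (summand-≥ c+sb≡m b<h)))
           (trans (odd-total c b) (cong (λ z → z + z) c+sb≡m)))
    where
    c<m : c < m
    c<m = subst (c <_) c+sb≡m (m<m+n c (s≤s z≤n))
  ...   | tri> _ _ h<b = slanted c (≤-trans sc<h (m≤m+n h h))
    (trans (cong (λ z → z + suc (b + b) + c) (low-< sc<h))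
           (trans (odd-total c b) (cong (λ z → z + z) c+sb≡m)))
    where
    sc<h : suc c < h
    sc<h = summand-< (trans (sym (+-suc c b)) c+sb≡m) h<b
  ...   | tri≈ _ refl _ = closing (c + b) (trans (sym (+-suc c b)) c+sb≡m) 0<h
    (trans (arith b (c + b)) (cong (m +_) (trans (sym (+-suc c b)) c+sb≡m)))
    where
    0<h : 0 < b
    0<h = ≤-trans (s≤s z≤n) (≤-reflexive (+-cancelʳ-≡ b (suc c) b (trans (sym (+-suc c b)) c+sb≡m)))
    arith : ∀ b z → suc (b + b) + z ≡ (b + b) + suc z
    arith = solve-∀
  differences D D< | b , inj₂ refl with m ∸ suc b
    | m∸n+n≡m (double-cancel-≤ {suc b} {m} (subst (_≤ m + m) (cong suc (sym (+-suc b b))) D<))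
  ... | c | c+sb≡m with <-≤-connex h (suc b)
  ...   | inj₁ h<sb = straight c (≤-trans c<h (m≤m+n h h))
    (trans (cong (λ z → z + suc (suc (b + b)) + c) (low-< c<h))
           (trans (arith c b) (cong (λ z → z + z) c+sb≡m)))
    where
    c<h : c < h
    c<h = summand-< c+sb≡m h<sb
    arith : ∀ c b → c + suc (suc (b + b)) + c ≡ (c + suc b) + (c + suc b)
    arith = solve-∀
  -- Here `b + 1 = 2h`, which contradicts `b + 1 ≤ h`.
  differences D D< | b , inj₂ refl | zero | c+sb≡m | inj₂ sb≤h =
    contradiction (≤-trans sb≤h (summand-≥ {0} c+sb≡m sb≤h)) λ ()
  differences D D< | b , inj₂ refl | suc c | c+sb≡m | inj₂ sb≤h = slanted c sc<m
    (trans (cong (λ z → z + suc (suc (b + b)) + c) (low-≥ (summand-≥ c+sb≡m sb≤h)))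
           (trans (arith c b) (cong (λ z → z + z) c+sb≡m)))
    where
    sc<m : suc c < m
    sc<m = subst (suc c <_) c+sb≡m (m<m+n (suc c) (s≤s z≤n))
    arith : ∀ c b → suc (suc c) + suc (suc (b + b)) + c ≡ (suc c + suc b) + (suc c + suc b)
    arith = solve-∀

  h≤n : h ≤ suc (m + m)
  h≤n = m≤n⇒m≤1+n (≤-trans (m≤m+n h h) (m≤m+n m m))

  nearHamiltonian : Design m 1 (Fin (suc (m + m)))
  nearHamiltonian = record { pt = pt ; pt-cover = pt-cover ; arc-cover = arc-cover }
    where
    pt : Fin (suc (m + m)) → Fin 1 → Bool → Fin m → Fin (suc (m + m))
    pt i _ s j = i ⊖ h ⊕ label s (toℕ j)
    pt-cover : ∀ i p → p ≡ i ⊎ ∃[ c ] ∃[ s ] ∃[ j ] pt i c s j ≡ p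
    pt-cover i p with gap (i ⊖ h) p
    ... | a , s≤s a≤ , eq with label-cover a≤
    ...   | inj₁ refl = inj₁ (trans (sym eq) (⊖-⊕ i h≤n))
    ...   | inj₂ (s , j , refl) = inj₂ (0F , s , j , eq)
    arc-cover : ∀ p q → p ≡ q ⊎
      ∃[ i ] ∃[ c ] ∃[ j ] ∃[ e ] (pt i c false (next e j) ≡ p × pt i c true j ≡ q)
    arc-cover p q with gap⁺ p q
    ... | inj₁ eq = inj₁ eq
    ... | inj₂ (D , s≤s D< , eq) with differences D D<
    ...   | j , e , total = inj₂ (i , 0F , j , e , p≡ , q≡)
      where
      open ≡-Reasoning
      b = low (toℕ (next e j))
      -- The translation by `p − b` takes the low label `b` to `p`; its hole is the image of `h`.
      i = p ⊖ b ⊕ h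
      p≡ : i ⊖ h ⊕ b ≡ p
      p≡ = trans (cong (_⊕ b) (⊕-⊖ (p ⊖ b) h≤n))
                 (⊖-⊕ p (≤-trans (low≤ (Finₚ.toℕ<n (next e j))) (m≤n⇒m≤1+n (m≤m+n m m))))
      q≡ : i ⊖ h ⊕ high (toℕ j) ≡ q
      q≡ = begin
        i ⊖ h ⊕ high (toℕ j)                ≡⟨ cong (λ z → i ⊖ h ⊕ (z ∸ toℕ j)) total ⟨
        i ⊖ h ⊕ (b + suc D + toℕ j ∸ toℕ j) ≡⟨ cong (i ⊖ h ⊕_) (m+n∸n≡m (b + suc D) (toℕ j)) ⟩
        i ⊖ h ⊕ (b + suc D)                 ≡⟨ cong (i ⊖ h ⊕_) (+-comm b (suc D)) ⟩
        i ⊖ h ⊕ (suc D + b)                 ≡⟨ ⊕-⊕ (i ⊖ h) b (suc D) ⟨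
        i ⊖ h ⊕ b ⊕ suc D                   ≡⟨ cong (_⊕ suc D) p≡ ⟩
        p ⊕ suc D                           ≡⟨ eq ⟩
        q                                   ∎

-- 1-frames

-- A 1-frame of type 2^(w+1): G × Bool is partitioned into the pairs {y} × Bool, and for every y
-- there are two perfect matchings (indexed by f) of the points outside {y} × Bool.
record Frame (w : ℕ) (G : Set) : Set₁ where
  field
    Q          : G → Set
    finite     : ∀ y → Finite (Q y) w
    end        : ∀ y → Bool → Q y → Bool → G × Bool
    end-cover  : ∀ y f v → proj₁ v ≡ y ⊎ ∃[ q ] ∃[ s ] end y f q s ≡ v
    pair-cover : ∀ v v′ → proj₁ v ≡ proj₁ v′ ⊎
                 ∃[ y ] ∃[ f ] ∃[ q ] ∃[ s ] (end y f q s ≡ v × end y f q (not s) ≡ v′)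

xor-cancel : ∀ a b → (a xor b) xor b ≡ a
xor-cancel a b = trans (xor-assoc a b b) (trans (cong (a xor_) (xor-same b)) (xor-identityʳ a))

same-or-opposite : ∀ a b → a ≡ b ⊎ not a ≡ b
same-or-opposite false false = inj₁ refl
same-or-opposite false true  = inj₂ refl
same-or-opposite true  false = inj₂ refl
same-or-opposite true  true  = inj₁ refl

xor-not : ∀ a s → (a xor s) xor not s ≡ not a
xor-not false false = refl
xor-not false true  = refl
xor-not true  false = refl
xor-not true  true  = refl

-- Reflection in `y` gives the pairs; one matching keeps the bit, the other flips it. Distinct
-- residues of odd modulus always have a midpoint to serve as `y`.
oddFrame : ∀ ρ → Frame (2 * ρ) (Fin (suc (ρ + ρ)))
oddFrame ρ = record
  { Q          = λ _ → Bool × Fin ρ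
  ; finite     = λ _ → finite-× finite-Bool ↔-refl
  ; end        = end
  ; end-cover  = end-cover
  ; pair-cover = pair-cover
  }
  where
  end : Fin (suc (ρ + ρ)) → Bool → Bool × Fin ρ → Bool → Fin (suc (ρ + ρ)) × Bool
  end y false (a , t) s = shift s y t , a
  end y true  (a , t) s = shift s y t , a xor s
  end-cover : ∀ y f v → proj₁ v ≡ y ⊎ ∃[ q ] ∃[ s ] end y f q s ≡ v
  end-cover y f (z , a) with shift-cover {ρ} y z
  ... | inj₁ eq = inj₁ eq
  end-cover y false (z , a) | inj₂ (s , t , eq) = inj₂ ((a , t) , s , cong (_, a) eq)
  end-cover y true  (z , a) | inj₂ (s , t , eq) = inj₂ ((a xor s , t) , s , cong₂ _,_ eq (xor-cancel a s))
  pair-cover : ∀ v v′ → proj₁ v ≡ proj₁ v′ ⊎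
    ∃[ y ] ∃[ f ] ∃[ q ] ∃[ s ] (end y f q s ≡ v × end y f q (not s) ≡ v′)
  pair-cover (p , a) (p′ , a′) with midpoint {ρ} p p′
  ... | inj₁ eq = inj₁ eq
  ... | inj₂ (y , t , s , refl , refl) with same-or-opposite a a′
  ...   | inj₁ refl = inj₂ (y , false , (a , t) , s , refl , refl)
  ...   | inj₂ refl = inj₂ (y , true , (a xor s , t) , s ,
                            cong (_ ,_) (xor-cancel a s) , cong (_ ,_) (xor-not a s))

-- As in the odd frame, except that for t = 1 the bit f is freed to join y ± 1 to the two points over
-- nothing, and the pairs {(y ± 1 , f)} lost by this are regained in the other matching.  What remains
-- uncovered are the pairs (p , false), (p ± 2 , true), which form the two matchings with hole nothing.
evenFrame : ∀ ρ → Frame (suc (2 * suc ρ)) (Maybe (Fin (suc (suc ρ + suc ρ))))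
evenFrame ρ = record
  { Q          = Q
  ; finite     = finite
  ; end        = end
  ; end-cover  = end-cover
  ; pair-cover = pair-cover
  }
  where
  Z : Set
  Z = Fin (suc (suc ρ + suc ρ))
  Q : Maybe Z → Set
  Q nothing  = Z
  Q (just _) = Maybe (Bool × Fin (suc ρ))
  size : ∀ ρ → suc (suc ρ + suc ρ) ≡ suc (2 * suc ρ)
  size = solve-∀
  finite : ∀ y → Finite (Q y) (suc (2 * suc ρ))
  finite nothing  = subst (Finite Z) (size ρ) ↔-refl
  finite (just _) = finite-Maybe (finite-× finite-Bool ↔-refl)
  step : Bool → Z → Z
  step s y = shift s y (Fin.zero {ρ})
  step-step : ∀ s y → step (not s) (step s y) ≡ y
  step-step s y = shift-shift s y (Fin.zero {ρ})
  twoSteps : Bool → Z → Z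
  twoSteps f p = step f (step f p)
  join : Bool → Z → Bool → Bool → Maybe Z × Bool
  join f y σ true  = just (step σ y) , f
  join f y σ false = nothing , not σ
  short : Bool → Z → Bool → Bool → Maybe Z × Bool
  short true  y f s = join f y true s
  short false y f s = just (step s y) , not f
  end : ∀ y → Bool → Q y → Bool → Maybe Z × Bool
  end nothing  f     p                        false = just p , false
  end nothing  f     p                        true  = just (twoSteps f p) , true
  end (just y) f     nothing                  s     = join f y false s
  end (just y) f     (just (a , 0F))          s     = short a y f s
  end (just y) false (just (a , Fin.suc t))   s     = just (shift s y (Fin.suc t)) , a
  end (just y) true  (just (a , Fin.suc t))   s     = just (shift s y (Fin.suc t)) , a xor s

  twoSteps-inverse : ∀ f p → twoSteps f (twoSteps (not f) p) ≡ p
  twoSteps-inverse true  p = trans (cong (step true) (step-step false (step false p))) (step-step false p)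
  twoSteps-inverse false p = trans (cong (step false) (step-step true (step true p))) (step-step true p)

  end-cover : ∀ y f v → proj₁ v ≡ y ⊎ ∃[ q ] ∃[ s ] end y f q s ≡ v
  end-cover nothing f (nothing , a) = inj₁ refl
  end-cover nothing f (just p , false) = inj₂ (p , false , refl)
  end-cover nothing f (just p , true) =
    inj₂ (twoSteps (not f) p , true , cong (λ z → just z , true) (twoSteps-inverse f p))
  end-cover (just y) f (nothing , false) = inj₂ (just (true , 0F) , false , refl)
  end-cover (just y) f (nothing , true)  = inj₂ (nothing , false , refl)
  end-cover (just y) f (just z , a) with shift-cover {suc ρ} y z
  ... | inj₁ eq = inj₁ (cong just eq)
  ... | inj₂ (s , 0F , refl) with same-or-opposite f a
  ...   | inj₂ refl = inj₂ (just (false , 0F) , s , refl)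
  end-cover (just y) f (just z , a) | inj₂ (true  , 0F , refl) | inj₁ refl = inj₂ (just (true , 0F) , true , refl)
  end-cover (just y) f (just z , a) | inj₂ (false , 0F , refl) | inj₁ refl = inj₂ (nothing , true , refl)
  end-cover (just y) false (just z , a) | inj₂ (s , Fin.suc t , refl) = inj₂ (just (a , Fin.suc t) , s , refl)
  end-cover (just y) true  (just z , a) | inj₂ (s , Fin.suc t , refl) =
    inj₂ (just (a xor s , Fin.suc t) , s , cong (_ ,_) (xor-cancel a s))

  Joined : Maybe Z × Bool → Maybe Z × Bool → Set
  Joined v v′ = ∃[ y ] ∃[ f ] ∃[ q ] ∃[ s ] (end y f q s ≡ v × end y f q (not s) ≡ v′)

  Joined-sym : ∀ {v v′} → Joined v v′ → Joined v′ v
  Joined-sym (y , f , q , s , e , e′) =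
    y , f , q , not s , e′ , trans (cong (end y f q) (not-involutive s)) e

  -- The hole is `p − 1` for `(nothing , false)` and `p + 1` for `(nothing , true)`, in the matching
  -- that frees the bit `a`.
  joined-∞ : ∀ p a b → Joined (just p , a) (nothing , b)
  joined-∞ p a false = just (step false p) , a , just (true , 0F) , true ,
    cong (λ z → just z , a) (step-step false p) , refl
  joined-∞ p a true  = just (step true p) , a , nothing , true ,
    cong (λ z → just z , a) (step-step true p) , refl

  across : ∀ s y → twoSteps (not s) (step s y) ≡ step (not s) y
  across true  y = cong (step false) (step-step true y)
  across false y = cong (step true) (step-step false y)

  -- These are the pairs left to the hole `nothing`; its two matchings are the two directions of the
  -- double step.
  joined-2 : ∀ s y → Joined (just (step s y) , false) (just (step (not s) y) , true)
  joined-2 s y = nothing , not s , step s y , false , refl , cong (λ z → just z , true) (across s y)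

  pair-cover : ∀ v v′ → proj₁ v ≡ proj₁ v′ ⊎ Joined v v′
  pair-cover (nothing , a) (nothing , b) = inj₁ refl
  pair-cover (just p  , a) (nothing , b) = inj₂ (joined-∞ p a b)
  pair-cover (nothing , a) (just p  , b) = inj₂ (Joined-sym (joined-∞ p b a))
  pair-cover (just p , a) (just p′ , a′) with midpoint {suc ρ} p p′
  ... | inj₁ eq = inj₁ (cong just eq)
  ... | inj₂ (y , Fin.suc t , s , refl , refl) with same-or-opposite a a′
  ...   | inj₁ refl = inj₂ (just y , false , just (a , Fin.suc t) , s , refl , refl)
  ...   | inj₂ refl = inj₂ (just y , true , just (a xor s , Fin.suc t) , s ,
                            cong (_ ,_) (xor-cancel a s) , cong (_ ,_) (xor-not a s))
  pair-cover (just p , a) (just p′ , a′) | inj₂ (y , 0F , s , refl , refl) with same-or-opposite a a′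
  -- The matching `not a` frees the other bit and so keeps the pair with bit `a`.
  ...   | inj₁ refl = inj₂ (just y , not a , just (false , 0F) , s ,
                            cong (_ ,_) (not-involutive a) , cong (_ ,_) (not-involutive a))
  pair-cover (just p , false) (just p′ , a′) | inj₂ (y , 0F , s , refl , refl) | inj₂ refl = inj₂ (joined-2 s y)
  -- With the bit `true` first the ends are exchanged, so the double step runs the other way.
  pair-cover (just p , true) (just p′ , a′) | inj₂ (y , 0F , s , refl , refl) | inj₂ refl =
    inj₂ (Joined-sym (subst (λ z → Joined (just (step (not s) y) , false) (just (step z y) , true))
                            (not-involutive s) (joined-2 (not s) y)))

-- Blowing up a frame

module Blowup (h : ℕ) where

  m : ℕ
  m = h + h

  -- Only sinks move, so sink `j` ends up at differences `2t + 1` and `2t` from its sources `j` and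
  -- `j + 1`.
  twist : Bool → Fin h → Fin m → Fin m
  twist false t j = j
  twist true  t j = j ⊕ suc (toℕ t + toℕ t)

  twist-≤ : ∀ (t : Fin h) → suc (toℕ t + toℕ t) ≤ m
  twist-≤ t = +-mono-<-≤ (Finₚ.toℕ<n t) (<⇒≤ (Finₚ.toℕ<n t))

  twist-surjective : ∀ s t j → ∃[ i ] twist s t i ≡ j
  twist-surjective false t j = j , refl
  twist-surjective true  t j = j ⊖ suc (toℕ t + toℕ t) , ⊖-⊕ j (twist-≤ t)

  -- The decomposition of K_{m,m} into the Hamiltonian cycles formed by the differences 2t and 2t + 1.
  hamiltonian : ∀ j j′ → ∃[ t ] ∃[ i ] ∃[ e ] (next e i ≡ j × twist true t i ≡ j′)
  hamiltonian j j′ with gap j j′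
  ... | a , a<m , eq with parity a
  ...   | b , inj₁ refl = fromℕ< b<h , j ⊖ 1 , true , back , (begin
    j ⊖ 1 ⊕ suc (toℕ t + toℕ t)  ≡⟨ cong (λ z → j ⊖ 1 ⊕ suc (z + z)) (Finₚ.toℕ-fromℕ< b<h) ⟩
    j ⊖ 1 ⊕ suc (b + b)          ≡⟨ cong (j ⊖ 1 ⊕_) (+-comm 1 (b + b)) ⟩
    j ⊖ 1 ⊕ (b + b + 1)          ≡⟨ ⊕-⊕ (j ⊖ 1) 1 (b + b) ⟨
    j ⊖ 1 ⊕ 1 ⊕ (b + b)          ≡⟨ cong (_⊕ (b + b)) (⊖-⊕ j 1≤m) ⟩
    j ⊕ (b + b)                  ≡⟨ eq ⟩
    j′                           ∎)
    where
    open ≡-Reasoning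
    b<h = double-cancel-< {b} {h} a<m
    t = fromℕ< b<h
    1≤m : 1 ≤ m
    1≤m = ≤-trans (s≤s z≤n) a<m
    back : cyc (j ⊖ 1) ≡ j
    back = trans (cyc≡⊕1 (j ⊖ 1)) (⊖-⊕ j 1≤m)
  ...   | b , inj₂ refl = fromℕ< b<h , j , false , refl ,
    trans (cong (λ z → j ⊕ suc (z + z)) (Finₚ.toℕ-fromℕ< b<h)) eq
    where
    b<h : b < h
    b<h = double-cancel-< {b} {h} (<⇒≤ a<m)

  K : Set
  K = Bool × Fin m

  -- The `4h` points of a group, as holes, stand for the choices of a matching, an orientation and
  -- one of `h` Hamiltonian cycles.
  decode : K → Bool × Bool × Fin h
  decode (f , j) with Fin.splitAt h j
  ... | inj₁ t = f , false , t
  ... | inj₂ t = f , true , t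

  encode : Bool → Bool → Fin h → K
  encode f false t = f , t Fin.↑ˡ h
  encode f true  t = f , h Fin.↑ʳ t

  decode-encode : ∀ f s t → decode (encode f s t) ≡ (f , s , t)
  decode-encode f false t rewrite Finₚ.splitAt-↑ˡ h t h = refl
  decode-encode f true  t rewrite Finₚ.splitAt-↑ʳ h h t = refl

  module _ {w : ℕ} {G : Set} (finG : Finite G (suc w)) (F : Frame w G) (B : Design m 1 (Maybe K)) where
    open Frame F
    module B = Design B

    P : Set
    P = Maybe (G × K)

    finite-P : Finite P (suc (suc w * (2 * m)))
    finite-P = finite-Maybe (finite-× finG (finite-× finite-Bool ↔-refl))

    into : G → Maybe K → P
    into y = Maybe.map (y ,_)

    spread : G × Bool → Fin m → P
    spread (z , b) j = just (z , b , j)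

    -- The bit `δ` decides which of the two matched halves carries the sources.
    across : (y : G) → Bool × Bool × Fin h → Q y → Bool → Fin m → P
    across y (f , δ , t) q s j = spread (end y f q (s xor δ)) (twist s t j)

    -- With hole `nothing`, every group carries one base cycle. With a hole in group `y`, cycle 0
    -- lies in that group together with `nothing`, and the other `w` cycles join matched halves of
    -- the remaining groups.
    point : P → Fin (suc w) → Bool → Fin m → P
    point nothing        c           s j = into (Inverse.from finG c) (B.pt nothing 0F s j)
    point (just (y , κ)) 0F          s j = into y (B.pt (just κ) 0F s j)
    point (just (y , κ)) (Fin.suc c) s j = across y (decode κ) (Inverse.from (finite y) c) s j

    point-nothing : ∀ y s j → point nothing (Inverse.to finG y) s j ≡ into y (B.pt nothing 0F s j)
    point-nothing y s j = cong (λ z → into z (B.pt nothing 0F s j)) (Inverse.strictlyInverseʳ finG y)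

    point-across : ∀ y κ q s j →
                   point (just (y , κ)) (Fin.suc (Inverse.to (finite y) q)) s j ≡ across y (decode κ) q s j
    point-across y κ q s j = cong (λ z → across y (decode κ) z s j) (Inverse.strictlyInverseʳ (finite y) q)

    Arc : P → P → Set
    Arc p q = ∃[ i ] ∃[ c ] ∃[ j ] ∃[ e ] (point i c false (next e j) ≡ p × point i c true j ≡ q)

    base-cover : ∀ y κ κ′ → κ′ ≡ just κ ⊎ ∃[ c ] ∃[ s ] ∃[ j ] point (just (y , κ)) c s j ≡ into y κ′
    base-cover y κ κ′ with B.pt-cover (just κ) κ′
    ... | inj₁ eq = inj₁ eq
    ... | inj₂ (0F , s , j , refl) = inj₂ (0F , s , j , refl)

    matched : ∀ y code v j → proj₁ v ≡ y ⊎ ∃[ q ] ∃[ s ] ∃[ i ] across y code q s i ≡ spread v j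
    matched y (f , δ , t) v j with end-cover y f v
    ... | inj₁ eq = inj₁ eq
    ... | inj₂ (q , s , refl) with twist-surjective (s xor δ) t j
    ...   | i , refl = inj₂ (q , s xor δ , i ,
      cong (λ z → spread (end y f q z) (twist (s xor δ) t i)) (xor-cancel s δ))

    across-cover : ∀ y κ v j → proj₁ v ≡ y ⊎ ∃[ c ] ∃[ s ] ∃[ i ] point (just (y , κ)) c s i ≡ spread v j
    across-cover y κ v j with matched y (decode κ) v j
    ... | inj₁ eq = inj₁ eq
    ... | inj₂ (q , s , i , eq) =
      inj₂ (Fin.suc (Inverse.to (finite y) q) , s , i , trans (point-across y κ q s i) eq)

    point-cover : ∀ i p → p ≡ i ⊎ ∃[ c ] ∃[ s ] ∃[ j ] point i c s j ≡ p
    point-cover nothing nothing = inj₁ refl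
    point-cover nothing (just (y , κ)) with B.pt-cover nothing (just κ)
    ... | inj₂ (0F , s , j , eq) =
      inj₂ (Inverse.to finG y , s , j , trans (point-nothing y s j) (cong (into y) eq))
    point-cover (just (y , κ)) nothing with base-cover y κ nothing
    ... | inj₂ found = inj₂ found
    point-cover (just (y , κ)) (just (y′ , b , j)) with across-cover y κ (y′ , b) j
    ... | inj₂ found = inj₂ found
    ... | inj₁ refl with base-cover y κ (just (b , j))
    ...   | inj₁ refl = inj₁ refl
    ...   | inj₂ found = inj₂ found

    base-arc : ∀ y κ κ′ → κ ≡ κ′ ⊎ Arc (into y κ) (into y κ′)
    base-arc y κ κ′ with B.arc-cover κ κ′
    ... | inj₁ eq = inj₁ eq
    ... | inj₂ (nothing , 0F , j , e , refl , refl) =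
      inj₂ (nothing , Inverse.to finG y , j , e , point-nothing y false (next e j) , point-nothing y true j)
    ... | inj₂ (just κ₀ , 0F , j , e , refl , refl) = inj₂ (just (y , κ₀) , 0F , j , e , refl , refl)

    -- The frame supplies the group `y`, the matching and the orientation, and `hamiltonian` the
    -- cycle `t`; encoding these picks the hole within `y`.
    across-arc : ∀ v v′ j j′ → proj₁ v ≡ proj₁ v′ ⊎ Arc (spread v j) (spread v′ j′)
    across-arc v v′ j j′ with pair-cover v v′
    ... | inj₁ eq = inj₁ eq
    ... | inj₂ (y , f , q , δ , refl , refl) with hamiltonian j j′
    ...   | t , i , e , refl , refl = inj₂ (just (y , κ) , Fin.suc (Inverse.to (finite y) q) , i , e , at false (next e i) , at true i)
      where
      κ = encode f δ t
      at : ∀ s i → point (just (y , κ)) (Fin.suc (Inverse.to (finite y) q)) s i ≡ across y (f , δ , t) q s i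
      at s i = trans (point-across y κ q s i) (cong (λ z → across y z q s i) (decode-encode f δ t))

    point-arc : ∀ p q → p ≡ q ⊎ Arc p q
    point-arc nothing nothing = inj₁ refl
    point-arc nothing (just (y , κ)) with base-arc y nothing (just κ)
    ... | inj₂ found = inj₂ found
    point-arc (just (y , κ)) nothing with base-arc y (just κ) nothing
    ... | inj₂ found = inj₂ found
    point-arc (just (y , b , j)) (just (y′ , b′ , j′)) with across-arc (y , b) (y′ , b′) j j′
    ... | inj₂ found = inj₂ found
    ... | inj₁ refl with base-arc y (just (b , j)) (just (b′ , j′))
    ...   | inj₁ refl = inj₁ refl
    ...   | inj₂ found = inj₂ found

    blowup : Design m (suc w) P
    blowup = record { pt = point ; pt-cover = point-cover ; arc-cover = point-arc }

-- Assembly by the parity of x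

arcs-of-frame : ∀ h ρ {w G} → Finite G (suc w) → Frame w G →
                ARCS ((h + h) * 2) ((h + h) * 2 * suc w + 1) (suc (ρ + ρ))
arcs-of-frame h ρ {w} finG F =
  Lift.arcs ρ (transport (resize (size₂ (h + h) w) (finite-P finG F B)) (blowup finG F B))
  where
  open Blowup h
  size₁ : ∀ m → suc (m + m) ≡ suc (2 * m)
  size₁ = solve-∀
  size₂ : ∀ m w → suc (suc w * (2 * m)) ≡ m * 2 * suc w + 1
  size₂ = solve-∀
  B : Design m 1 (Maybe K)
  B = transport (↔-sym (resize (sym (size₁ m)) (finite-Maybe (finite-× finite-Bool ↔-refl))))
                (Labels.nearHamiltonian h)

double : ∀ a → 2 * a ≡ a + a
double = solve-∀

arcs-of-order : ∀ h ρ x → 0 < x → x ≢ 2 → ARCS ((h + h) * 2) ((h + h) * 2 * x + 1) (suc (ρ + ρ))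
arcs-of-order h ρ zero () x≢2
arcs-of-order h ρ (suc w) 0<x x≢2 with parity w
-- Odd `x`, including `x = 1` as the frame with a single group and empty matchings.
... | ρ′ , inj₁ refl =
  subst (λ z → ARCS ((h + h) * 2) ((h + h) * 2 * suc z + 1) (suc (ρ + ρ))) (double ρ′)
        (arcs-of-frame h ρ (resize (cong suc (sym (double ρ′))) ↔-refl) (oddFrame ρ′))
-- Here `x = 2`; the even frames start at `x = 4`, with an odd cycle of length 3 and one more point.
... | zero , inj₂ refl = contradiction refl x≢2
... | suc ρ′ , inj₂ refl =
  subst (λ z → ARCS ((h + h) * 2) ((h + h) * 2 * suc (suc z) + 1) (suc (ρ + ρ))) (double (suc ρ′))
        (arcs-of-frame h ρ (finite-Maybe (resize (cong suc (sym (double (suc ρ′)))) ↔-refl)) (evenFrame ρ′))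

theorem4p2 : (k x g : ℕ) → 0 < k → 4 ∣ k → 0 < x → x ≢ 2 →
    3 ≤ g → ¬ (2 ∣ g) → ARCS k (k * x + 1) g
theorem4p2 k x g _ (divides h k≡) 0<x x≢2 _ g-odd with parity g
... | ρ , inj₁ refl = contradiction (divides ρ (trans (sym (double ρ)) (*-comm 2 ρ))) g-odd
... | ρ , inj₂ refl =
  -- With `2h` sources and `2h` sinks a cycle has length `(h + h) * 2`, which is `k`.
  subst (λ z → ARCS z (z * x + 1) (suc (ρ + ρ))) (trans (quadruple h) (sym k≡)) (arcs-of-order h ρ x 0<x x≢2)
  where
  quadruple : ∀ h → (h + h) * 2 ≡ h * 4
  quadruple = solve-∀
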